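{- Average-energy games are determined and both players have memoryless optimal strategies. That is, for every game $G=(S_1,S_2,E,w)$ and every initial state $s_{\mathrm{init}}\in S$: (i) for every $t\in\mathbb{Q}$, either player 1 has a winning strategy from $s_{\mathrm{init}}$ for the objective $\mathsf{AvgEnergy}(t)$, or player 2 has a winning strategy from $s_{\mathrm{init}}$ against it; (ii) letting $v\in\mathbb{R}\cup\{ -\infty,+\infty\}$ be the average-energy value from $s_{\mathrm{init}}$, there is a memoryless strategy $\sigma_1$ of player 1 such that every play $\pi$ from $s_{\mathrm{init}}$ consistent with $\sigma_1$ satisfies $\overline{AE}(\pi)\le v$, and there is a memoryless strategy $\sigma_2$ of player 2 such that every play $\pi$ from $s_{\mathrm{init}}$ consistent with $\sigma_2$ satisfies $\overline{AE}(\pi)\ge v$.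
   Context: A game is a tuple $G=(S_1,S_2,E,w)$ where $S_1,S_2$ are disjoint finite sets of states belonging to player 1 and player 2, $S=S_1\uplus S_2$, $E\subseteq S\times S$ is a finite set of edges such that every state has at least one outgoing edge, and $w\colon E\to\mathbb{Z}$ is an integer weight function. A play from $s_{\mathrm{init}}$ is an infinite sequence $\pi=s_0s_1s_2\dots$ with $s_0=s_{\mathrm{init}}$ and $(s_i,s_{i+1})\in E$ for all $i\ge 0$; $\pi(n)=s_0\dots s_n$ is its prefix up to position $n$. A strategy for player $i$ is a function $\sigma_i$ mapping each finite prefix ending in a state of $S_i$ to a successor (along an edge) of its last state; it is memoryless if it depends only on the last state. A play $\pi$ is consistent with $\sigma_i$ if $\sigma_i(\pi(n))=s_{n+1}$ whenever $s_n\in S_i$. Strategies of the two players and $s_{\mathrm{init}}$ determine a unique play, the outcome. The energy level is $\mathrm{EL}(\pi(n))=\sum_{i=0}^{n-1}w(s_i,s_{i+1})$, and the average-energy of $\pi$ is $\overline{AE}(\pi)=\limsup_{n\to\infty}\frac1n\sum_{i=1}^{n}\mathrm{EL}(\pi(i))$. For $t\in\mathbb{Q}$, $\mathsf{AvgEnergy}(t)$ is the set of plays $\pi$ with $\overline{AE}(\pi)\le t$. A strategy of player 1 is winning from $s_{\mathrm{init}}$ for an objective $\mathcal W$ (a set of plays) if, for every strategy of player 2, the outcome lies in $\mathcal W$; a strategy of player 2 is winning (against $\mathcal W$) if, for every strategy of player 1, the outcome does not lie in $\mathcal W$. The average-energy value from $s_{\mathrm{init}}$ is $v=\inf\{t\in\mathbb{Q}\mid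 \text{player 1 has a winning strategy from } s_{\mathrm{init}} \text{ for } \mathsf{AvgEnergy}(t)\}$ (with $\inf\emptyset=+\infty$). -}

module Defs where

open import Data.Bool.Base using (Bool; T)
open import Data.Fin.Base using (Fin)
open import Data.Integer.Base as ℤ using (ℤ; 0ℤ)
open import Data.Nat.Base as ℕ using (ℕ; zero; suc)
open import Data.Product.Base using (Σ; ∃; _×_; _,_; proj₁; proj₂)
open import Data.Rational.Base as ℚ using (ℚ)
import Data.Rational.Properties as ℚ
open import Data.Sum.Base using (_⊎_; inj₁; inj₂)
open import Function.Base using (_∘_)
open import Relation.Binary.PropositionalEquality
open import Relation.Nullary.Negation.Core using (¬_)

------------------------------------------------------------------------
-- Extended reals

-- An element x of ℝ ∪ {-∞, +∞} is given by the cut { q ∈ ℚ ∣ x < q }, an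
-- upward closed set without least element. The empty set is +∞ and the
-- whole of ℚ is -∞. Only one side of the cut is kept because arbitrary
-- infima and suprema, hence limits superior, then exist constructively;
-- classically that side determines the other.

record ℝ̄ : Set₁ where
  infix 4 _<ᶜ_
  field
    _<ᶜ_  : ℚ → Set
    up    : ∀ {p q} → p ℚ.< q → _<ᶜ_ p → _<ᶜ_ q
    round : ∀ {q} → _<ᶜ_ q → ∃ λ p → p ℚ.< q × _<ᶜ_ p

open ℝ̄ using (_<ᶜ_; up; round)

infix 4 _≤ᴿ_

_≤ᴿ_ : ℝ̄ → ℝ̄ → Set
x ≤ᴿ y = ∀ q → y <ᶜ q → x <ᶜ q

fromℚ : ℚ → ℝ̄
fromℚ t = record
  { _<ᶜ_  = λ q → t ℚ.< q
  ; up    = λ p<q t<p → ℚ.<-trans t<p p<q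
  ; round = λ t<q → let p , t<p , p<q = ℚ.<-dense t<q in p , p<q , t<p
  }

⨅ : {I : Set} → (I → ℝ̄) → ℝ̄
⨅ x = record
  { _<ᶜ_  = λ q → ∃ λ i → x i <ᶜ q
  ; up    = λ { p<q (i , xᵢ<p) → i , up (x i) p<q xᵢ<p }
  ; round = λ { (i , xᵢ<q) → let p , p<q , xᵢ<p = round (x i) xᵢ<q
                              in p , p<q , i , xᵢ<p }
  }

-- The bound p < q makes the cut open: an intersection of open cuts need
-- not be.
⨆ : {I : Set} → (I → ℝ̄) → ℝ̄
⨆ x = record
  { _<ᶜ_  = λ q → ∃ λ p → p ℚ.< q × (∀ i → x i <ᶜ p)
  ; up    = λ { q<r (p , p<q , x<p) → p , ℚ.<-trans p<q q<r , x<p }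
  ; round = λ { (p , p<q , x<p) → let r , p<r , r<q = ℚ.<-dense p<q
                                   in r , r<q , p , p<r , x<p }
  }

inf : (ℚ → Set) → ℝ̄
inf A = ⨅ {Σ ℚ A} (fromℚ ∘ proj₁)

limsup : (ℕ → ℚ) → ℝ̄
limsup a = ⨅ λ N → ⨆ λ k → fromℚ (a (N ℕ.+ k))

fromℚ-mono : ∀ {p q} → p ℚ.≤ q → fromℚ p ≤ᴿ fromℚ q
fromℚ-mono p≤q _ q<r = ℚ.≤-<-trans p≤q q<r

fromℚ-cancel : ∀ {p q} → fromℚ p ≤ᴿ fromℚ q → p ℚ.≤ q
fromℚ-cancel {p} p≤q = ℚ.≮⇒≥ λ q<p → ℚ.<-irrefl refl (p≤q p q<p)

⨅-lower : {I : Set} (x : I → ℝ̄) → ∀ i → ⨅ x ≤ᴿ x i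
⨅-lower x i _ xᵢ<q = i , xᵢ<q

⨅-greatest : {I : Set} (x : I → ℝ̄) {y : ℝ̄} → (∀ i → y ≤ᴿ x i) → y ≤ᴿ ⨅ x
⨅-greatest x y≤x q (i , xᵢ<q) = y≤x i q xᵢ<q

⨆-upper : {I : Set} (x : I → ℝ̄) → ∀ i → x i ≤ᴿ ⨆ x
⨆-upper x i _ (_ , p<q , x<p) = up (x i) p<q (x<p i)

⨆-least : {I : Set} (x : I → ℝ̄) {y : ℝ̄} → (∀ i → x i ≤ᴿ y) → ⨆ x ≤ᴿ y
⨆-least x {y} x≤y q y<q =
  let p , p<q , y<p = round y y<q in p , p<q , λ i → x≤y i p y<p

------------------------------------------------------------------------
-- Games

data Player : Set where
  player₁ player₂ : Player

record Game : Set where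
  field
    ∣S₁∣ ∣S₂∣ : ℕ

  S₁ : Set
  S₁ = Fin ∣S₁∣

  S₂ : Set
  S₂ = Fin ∣S₂∣

  S : Set
  S = S₁ ⊎ S₂

  field
    E : S → S → Bool

  infix 4 _⟶_
  _⟶_ : S → S → Set
  s ⟶ s′ = T (E s s′)

  Successor : S → Set
  Successor s = Σ S λ s′ → s ⟶ s′

  field
    total : ∀ s → Successor s
    w     : ∀ s s′ → s ⟶ s′ → ℤ

  owner : S → Player
  owner (inj₁ _) = player₁
  owner (inj₂ _) = player₂

module _ (G : Game) where
  open Game G

  -- The paths from s₀ to s. As T b has at most one proof, a path amounts to
  -- its sequence of states.
  infixl 5 _▹_
  data Prefix (s₀ : S) : S → Set where
    [•] : Prefix s₀ s₀
    _▹_ : ∀ {s s′} → Prefix s₀ s → s ⟶ s′ → Prefix s₀ s′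

  record Play : Set where
    field
      at   : ℕ → S
      edge : ∀ i → at i ⟶ at (suc i)

  record Strategy (i : Player) : Set where
    field
      move : ∀ {s₀ s} → Prefix s₀ s → owner s ≡ i → Successor s

module _ {G : Game} where
  open Game G
  open Play
  open Strategy

  prefix : (π : Play G) (n : ℕ) → Prefix G (at π 0) (at π n)
  prefix π zero    = [•]
  prefix π (suc n) = prefix π n ▹ edge π n

  Memoryless : ∀ {i} → Strategy G i → Set
  Memoryless {i} σ =
    ∀ {s₀ s₀′ s} (h : Prefix G s₀ s) (h′ : Prefix G s₀′ s) (o : owner s ≡ i) →
    proj₁ (move σ h o) ≡ proj₁ (move σ h′ o)

  Consistent : ∀ {i} → Strategy G i → Play G → Set
  Consistent {i} σ π =
    ∀ n (o : owner (at π n) ≡ i) →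
    proj₁ (move σ (prefix π n) o) ≡ at π (suc n)

  module Outcome (σ₁ : Strategy G player₁) (σ₂ : Strategy G player₂)
                 (s₀ : S) where

    next : ∀ {s} → Prefix G s₀ s → Successor s
    next {inj₁ _} h = move σ₁ h refl
    next {inj₂ _} h = move σ₂ h refl

    history : ℕ → Σ S (Prefix G s₀)
    history zero    = s₀ , [•]
    history (suc n) = let s , h = history n ; s′ , e = next h in s′ , h ▹ e

    outcome : Play G
    outcome .at n   = proj₁ (history n)
    outcome .edge n = proj₂ (next (proj₂ (history n)))

    prefix-outcome : ∀ n → prefix outcome n ≡ proj₂ (history n)
    prefix-outcome zero    = refl
    prefix-outcome (suc n) = cong (_▹ edge outcome n) (prefix-outcome n)

    next₁ : ∀ {s} (h : Prefix G s₀ s) o → move σ₁ h o ≡ next h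
    next₁ {inj₁ _} h refl = refl

    next₂ : ∀ {s} (h : Prefix G s₀ s) o → move σ₂ h o ≡ next h
    next₂ {inj₂ _} h refl = refl

    consistent₁ : Consistent σ₁ outcome
    consistent₁ n o rewrite prefix-outcome n =
      cong proj₁ (next₁ (proj₂ (history n)) o)

    consistent₂ : Consistent σ₂ outcome
    consistent₂ n o rewrite prefix-outcome n =
      cong proj₁ (next₂ (proj₂ (history n)) o)

  open Outcome public using (outcome)

  EL : ∀ {s₀ s} → Prefix G s₀ s → ℤ
  EL [•]                = 0ℤ
  EL (_▹_ {s} {s′} h e) = EL h ℤ.+ w s s′ e

  totalEL : Play G → ℕ → ℤ
  totalEL π zero    = 0ℤ
  totalEL π (suc n) = totalEL π n ℤ.+ EL (prefix π (suc n))

  meanEL : Play G → (n : ℕ) → .{{ℕ.NonZero n}} → ℚ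
  meanEL π n = totalEL π n ℚ./ n

  AE : Play G → ℝ̄
  AE π = limsup λ n → meanEL π (suc n)

  Objective : Set₁
  Objective = Play G → Set

  AvgEnergy : ℚ → Objective
  AvgEnergy t π = AE π ≤ᴿ fromℚ t

  Winning₁ : S → Objective → Strategy G player₁ → Set
  Winning₁ s W σ₁ = ∀ σ₂ → W (outcome σ₁ σ₂ s)

  Winning₂ : S → Objective → Strategy G player₂ → Set
  Winning₂ s W σ₂ = ∀ σ₁ → ¬ W (outcome σ₁ σ₂ s)

value : (G : Game) → Game.S G → ℝ̄
value G s = inf λ t →
  ∃ λ (σ₁ : Strategy G player₁) → Winning₁ s (AvgEnergy t) σ₁

{-# OPTIONS --safe #-}

-- Discount the game by 1 - ε with ε a positive infinitesimal, i.e. compare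
-- payoffs as power series in ε, lexicographically by coefficients. To finite
-- precision the optimality equation has a solution v = a₀ + a₁ ε + a₂ ε² + ⋯:
-- it is explicit when every state has one move, and if a list of moves at a
-- state is split in two, then one of the two solutions solves the whole unless
-- they agree. Up to scaling, a₀ is the mean payoff and, where a₀ = 0, a₁ is the
-- average-energy value. Indeed, if player 1 always moves optimally and a₀ = 0,
-- then energy + a₁ never increases, and along the moves which leave it constant
-- the next coefficient of the equation makes a₂ a potential bounding the sum
-- of - a₁. Hence the energies up to time n sum to at most a₁ n + O(1), while
-- a₀ < 0 gives the same bound with a₁ replaced by any constant. Exchanging the
-- players and changing signs bounds the plays of player 2 from below.
module Submission where

open import Data.Bool.Properties using (T-irrelevant; T?)
open import Data.Empty using (⊥; ⊥-elim)
open import Data.Fin.Base as Fin using (Fin)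
import Data.Fin.Properties as Fin
open import Data.Integer.Base hiding (suc)
open import Data.Integer.Properties hiding (_≟_; _≤?_)
open import Data.Integer.Tactic.RingSolver using (solve-∀)
open import Data.List.Base using (List; []; _∷_; _++_; tabulate)
open import Data.List.Membership.Propositional using (_∈_; _∉_)
open import Data.List.Membership.Propositional.Properties using (∈-tabulate⁺)
open import Data.List.Relation.Unary.All as All using (All; []; _∷_)
import Data.List.Relation.Unary.All.Properties as All
open import Data.List.Relation.Unary.Any as Any using (Any; here; there)
import Data.List.Relation.Unary.Any.Properties as Any
open import Data.Nat.Base as ℕ using (ℕ; zero; suc; _!)
open import Data.Nat.Divisibility using (_∣_; divides; ∣-trans; m≤n⇒m!∣n!; m∣m*n)
open import Data.Nat.GeneralisedArithmetic using (fold; iterate)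
import Data.Nat.Properties as ℕ
open import Data.Product.Base using (Σ; ∃; _×_; _,_; proj₁; proj₂)
open import Data.Rational.Base as ℚ using (ℚ; ↥_; ↧_; ↧ₙ_)
import Data.Rational.Properties as ℚ
import Data.Rational.Unnormalised.Base as ℚᵘ
import Data.Rational.Unnormalised.Properties as ℚᵘ
open import Data.Sum.Base using (_⊎_; inj₁; inj₂)
import Data.Sum.Properties as Sum
open import Function.Base using (_∘_)
open import Relation.Binary.Definitions using (tri<; tri≈; tri>)
open import Relation.Binary.PropositionalEquality
open import Relation.Nullary
import Relation.Nullary.Decidable as Dec
open import Defs
open ℝ̄

-- Power series in ε and their truncated lexicographic order

Series : Set
Series = ℕ → ℤ

infixl 6 _⊞_ _⊟_
infixr 7 _•_

_⊞_ _⊟_ : Series → Series → Series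
(x ⊞ y) n = x n + y n
(x ⊟ y) n = x n - y n

_•_ : ℤ → Series → Series
(c • x) n = c * x n

-- Multiplication by 1 - ε.
Λ : Series → Series
Λ x zero    = x zero
Λ x (suc n) = x (suc n) - x n

-- Nonnegativity modulo ε^m, for a positive infinitesimal ε.
data NonNeg : ℕ → Series → Set where
  done : ∀ {z} → NonNeg 0 z
  lead : ∀ {m z} → 0ℤ < z 0 → NonNeg (suc m) z
  cont : ∀ {m z} → z 0 ≡ 0ℤ → NonNeg m (z ∘ suc) → NonNeg (suc m) z

nonNeg-resp : ∀ {m x y} → x ≗ y → NonNeg m x → NonNeg m y
nonNeg-resp x≗y done       = done
nonNeg-resp x≗y (lead p)   = lead (subst (0ℤ <_) (x≗y 0) p)
nonNeg-resp x≗y (cont e p) =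
  cont (trans (sym (x≗y 0)) e) (nonNeg-resp (x≗y ∘ suc) p)

nonNeg-pred : ∀ {m x} → NonNeg (suc m) x → NonNeg m x
nonNeg-pred {zero}  _          = done
nonNeg-pred {suc m} (lead p)   = lead p
nonNeg-pred {suc m} (cont e p) = cont e (nonNeg-pred p)

nonNeg-⊞ : ∀ {m x y} → NonNeg m x → NonNeg m y → NonNeg m (x ⊞ y)
nonNeg-⊞ done       _          = done
nonNeg-⊞ (lead p)   (lead q)   = lead (+-mono-< p q)
nonNeg-⊞ (lead p)   (cont e q) = lead (+-mono-<-≤ p (≤-reflexive (sym e)))
nonNeg-⊞ (cont d p) (lead q)   = lead (+-mono-≤-< (≤-reflexive (sym d)) q)
nonNeg-⊞ (cont d p) (cont e q) = cont (cong₂ _+_ d e) (nonNeg-⊞ p q)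

nonNeg-total : ∀ m x → NonNeg m x ⊎ NonNeg m (-_ ∘ x)
nonNeg-total zero    x = inj₁ done
nonNeg-total (suc m) x with <-cmp 0ℤ (x 0)
... | tri< 0<x _ _ = inj₁ (lead 0<x)
... | tri> _ _ x<0 = inj₂ (lead (neg-mono-< x<0))
... | tri≈ _ 0≡x _ with nonNeg-total m (x ∘ suc)
...   | inj₁ p = inj₁ (cont (sym 0≡x) p)
...   | inj₂ p = inj₂ (cont (cong -_ (sym 0≡x)) p)

-- The constant term of `1 - ε` is 1, so the first nonzero coefficient keeps its place and its
-- value. When the constant term of `x` vanishes, `Λ` commutes with dropping it.
nonNeg-Λ : ∀ {m x} → NonNeg m x → NonNeg m (Λ x)
nonNeg-Λ done           = done
nonNeg-Λ (lead p)       = lead p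
nonNeg-Λ {x = x} (cont e p) = cont e (nonNeg-resp tail (nonNeg-Λ p))
  where
  tail : Λ (x ∘ suc) ≗ Λ x ∘ suc
  tail zero    = sym (trans (cong (λ i → x 1 - i) e) (+-identityʳ (x 1)))
  tail (suc n) = refl

infix 4 _≤⟨_⟩_

_≤⟨_⟩_ : Series → ℕ → Series → Set
x ≤⟨ m ⟩ y = NonNeg m (y ⊟ x)

≤⟨⟩-trans : ∀ {m} x y z → x ≤⟨ m ⟩ y → y ≤⟨ m ⟩ z → x ≤⟨ m ⟩ z
≤⟨⟩-trans x y z p q =
  nonNeg-resp (λ n → lemma (x n) (y n) (z n)) (nonNeg-⊞ p q)
  where
  lemma : ∀ a b c → (b - a) + (c - b) ≡ c - a
  lemma = solve-∀

≤⟨⟩-total : ∀ m x y → x ≤⟨ m ⟩ y ⊎ y ≤⟨ m ⟩ x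
≤⟨⟩-total m x y with nonNeg-total m (y ⊟ x)
... | inj₁ p = inj₁ p
... | inj₂ p = inj₂ (nonNeg-resp (λ n → lemma (x n) (y n)) p)
  where
  lemma : ∀ a b → - (b - a) ≡ a - b
  lemma = solve-∀

≤⟨⟩-reflexive : ∀ {m} x y → x ≗ y → x ≤⟨ m ⟩ y
≤⟨⟩-reflexive {zero}  x y x≗y = done
≤⟨⟩-reflexive {suc m} x y x≗y =
  cont (i≡j⇒i-j≡0 (sym (x≗y 0)))
    (nonNeg-resp (λ _ → refl) (≤⟨⟩-reflexive (x ∘ suc) (y ∘ suc) (x≗y ∘ suc)))

Λ-cong : ∀ {x y} → x ≗ y → Λ x ≗ Λ y
Λ-cong x≗y zero    = x≗y 0
Λ-cong x≗y (suc n) = cong₂ _-_ (x≗y (suc n)) (x≗y n)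

Λ-⊞ : ∀ x y → Λ (x ⊞ y) ≗ Λ x ⊞ Λ y
Λ-⊞ x y zero    = refl
Λ-⊞ x y (suc n) = lemma (x (suc n)) (y (suc n)) (x n) (y n)
  where
  lemma : ∀ a b c d → (a + b) - (c + d) ≡ (a - c) + (b - d)
  lemma = solve-∀

Λ-⊟ : ∀ x y → Λ (x ⊟ y) ≗ Λ x ⊟ Λ y
Λ-⊟ x y zero    = refl
Λ-⊟ x y (suc n) = lemma (x (suc n)) (y (suc n)) (x n) (y n)
  where
  lemma : ∀ a b c d → (a - b) - (c - d) ≡ (a - c) - (b - d)
  lemma = solve-∀

Λ-• : ∀ c x → Λ (c • x) ≗ c • Λ x
Λ-• c x zero    = refl
Λ-• c x (suc n) = lemma c (x (suc n)) (x n)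
  where
  lemma : ∀ c a b → c * a - c * b ≡ c * (a - b)
  lemma = solve-∀

-- Λ d - d = - ε d, so the coefficients of - d are shifted by one: this is the
-- only source of loss of precision.
Λ-contracts : ∀ {m} d → d ≤⟨ suc m ⟩ Λ d → NonNeg m (-_ ∘ d)
Λ-contracts d (lead 0<d-d) = ⊥-elim (<-irrefl (sym (+-inverseʳ (d 0))) 0<d-d)
Λ-contracts d (cont _ p)   = nonNeg-resp (λ n → lemma (d (suc n)) (d n)) p
  where
  lemma : ∀ a b → (a - b) - a ≡ - b
  lemma = solve-∀

-- Comparison in favour of a player

meet : ∀ {A : Set} {P Q : A → Set} {xs} → All P xs → Any Q xs →
       ∃ λ x → P x × Q x
meet ps q = Any.lookup q , All.lookupAny ps q

-- Player 1 minimises and player 2 maximises: to precision `m`, `x` is at least as good for the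
-- player as `y`.
Ord : Player → ℕ → Series → Series → Set
Ord player₁ m x y = x ≤⟨ m ⟩ y
Ord player₂ m x y = y ≤⟨ m ⟩ x

Ord-pred : ∀ p {m x y} → Ord p (suc m) x y → Ord p m x y
Ord-pred player₁ = nonNeg-pred
Ord-pred player₂ = nonNeg-pred

Ord-trans : ∀ p {m} x y z → Ord p m x y → Ord p m y z → Ord p m x z
Ord-trans player₁ x y z p q = ≤⟨⟩-trans x y z p q
Ord-trans player₂ x y z p q = ≤⟨⟩-trans z y x q p

Ord-total : ∀ p m x y → Ord p m x y ⊎ Ord p m y x
Ord-total player₁ m x y = ≤⟨⟩-total m x y
Ord-total player₂ m x y = ≤⟨⟩-total m y x

Ord-reflexive : ∀ p {m} x y → x ≗ y → Ord p m x y
Ord-reflexive player₁ x y x≗y = ≤⟨⟩-reflexive x y x≗y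
Ord-reflexive player₂ x y x≗y = ≤⟨⟩-reflexive y x (sym ∘ x≗y)

-- Discounted sums in functional graphs

iterate-+ : ∀ {A : Set} (f : A → A) x m n →
            iterate f x (m ℕ.+ n) ≡ iterate f (iterate f x m) n
iterate-+ f x zero    n = refl
iterate-+ f x (suc m) n = iterate-+ f (f x) m n

iterate-* : ∀ {A : Set} (f : A → A) x n → iterate f x n ≡ x → ∀ k →
            iterate f x (k ℕ.* n) ≡ x
iterate-* f x n eq zero    = refl
iterate-* f x n eq (suc k) = trans (iterate-+ f x n (k ℕ.* n))
  (trans (cong (λ y → iterate f y (k ℕ.* n)) eq) (iterate-* f x n eq k))

suc∣! : ∀ {k n} → k ℕ.< n → suc k ∣ n !
suc∣! {k} k<n = ∣-trans (m∣m*n (k !)) (m≤n⇒m!∣n! k<n)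

-- By the pigeonhole principle two of the iterates 0 to `n` coincide. Hence the `n`-th iterate
-- already lies on a cycle, whose length is at most `n` and so divides `n !`.
iterate-period : ∀ {A : Set} {n} (encode : A → Fin n) →
  (∀ {x y} → encode x ≡ encode y → x ≡ y) →
  ∀ (f : A → A) x → iterate f x (n ℕ.+ n !) ≡ iterate f x n
iterate-period {n = n} encode injective f x
  with Fin.pigeonhole (ℕ.n<1+n n) (λ i → encode (iterate f x (Fin.toℕ i)))
... | i , j , i<j , eq
  with ℕ.m≤n⇒∃[o]m+o≡n i<j | ℕ.m≤n⇒∃[o]m+o≡n (ℕ.≤-pred (Fin.toℕ<n i))
...   | d , i+d≡j | r , i+r≡n = trans (iterate-+ f x n (n !)) cycle!
  where
  a = Fin.toℕ i
  x′ = iterate f x a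
  period : iterate f x′ (suc d) ≡ x′
  period = trans (sym (iterate-+ f x a (suc d)))
    (trans (cong (iterate f x) (trans (ℕ.+-suc a d) i+d≡j)) (sym (injective eq)))
  cycle : iterate f (iterate f x n) (suc d) ≡ iterate f x n
  cycle = begin
    iterate f (iterate f x n) (suc d)   ≡⟨ iterate-+ f x n (suc d) ⟨
    iterate f x (n ℕ.+ suc d)           ≡⟨ cong (λ k → iterate f x (k ℕ.+ suc d)) i+r≡n ⟨
    iterate f x (a ℕ.+ r ℕ.+ suc d)     ≡⟨ cong (iterate f x)
      (trans (ℕ.+-assoc a r (suc d)) (cong (a ℕ.+_) (ℕ.+-comm r (suc d)))) ⟩
    iterate f x (a ℕ.+ (suc d ℕ.+ r))   ≡⟨ iterate-+ f x a (suc d ℕ.+ r) ⟩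
    iterate f x′ (suc d ℕ.+ r)          ≡⟨ iterate-+ f x′ (suc d) r ⟩
    iterate f (iterate f x′ (suc d)) r  ≡⟨ cong (λ y → iterate f y r) period ⟩
    iterate f x′ r                      ≡⟨ iterate-+ f x a r ⟨
    iterate f x (a ℕ.+ r)               ≡⟨ cong (iterate f x) i+r≡n ⟩
    iterate f x n                       ∎
    where open ≡-Reasoning
  cycle! : iterate f (iterate f x n) (n !) ≡ iterate f x n
  cycle! with suc∣! {d} {n} (ℕ.≤-trans
    (ℕ.m+n≤o⇒n≤o a (ℕ.≤-reflexive (trans (ℕ.+-suc a d) i+d≡j)))
    (ℕ.≤-pred (Fin.toℕ<n j)))
  ... | divides k n!≡ =
    trans (cong (iterate f (iterate f x n)) n!≡) (iterate-* f _ (suc d) cycle k)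

Λ^ : ℕ → Series → Series
Λ^ k x = fold x Λ k

Λ^-cong : ∀ k {x y} → x ≗ y → Λ^ k x ≗ Λ^ k y
Λ^-cong zero    x≗y = x≗y
Λ^-cong (suc k) x≗y = Λ-cong (Λ^-cong k x≗y)

Λ^-⊟ : ∀ k x y → Λ^ k (x ⊟ y) ≗ Λ^ k x ⊟ Λ^ k y
Λ^-⊟ zero    x y n = refl
Λ^-⊟ (suc k) x y n = trans (Λ-cong (Λ^-⊟ k x y) n) (Λ-⊟ (Λ^ k x) (Λ^ k y) n)

Λ^-• : ∀ k c x → Λ^ k (c • x) ≗ c • Λ^ k x
Λ^-• zero    c x n = refl
Λ^-• (suc k) c x n = trans (Λ-cong (Λ^-• k c x) n) (Λ-• c (Λ^ k x) n)

Λ^-Λ : ∀ k x → Λ^ k (Λ x) ≡ Λ (Λ^ k x)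
Λ^-Λ zero    x = refl
Λ^-Λ (suc k) x = cong Λ (Λ^-Λ k x)

Λ^-+ : ∀ j k x → Λ^ (j ℕ.+ k) x ≡ Λ^ j (Λ^ k x)
Λ^-+ zero    k x = refl
Λ^-+ (suc j) k x = cong Λ (Λ^-+ j k x)

one : Series
one zero    = 1ℤ
one (suc _) = 0ℤ

Λ^-one₀ : ∀ k → Λ^ k one 0 ≡ 1ℤ
Λ^-one₀ zero    = refl
Λ^-one₀ (suc k) = Λ^-one₀ k

Λ^-one₁ : ∀ k → Λ^ k one 1 ≡ - + k
Λ^-one₁ zero    = refl
Λ^-one₁ (suc k) = trans (cong₂ _-_ (Λ^-one₁ k) (Λ^-one₀ k)) (lemma (+ k))
  where
  lemma : ∀ i → - i - 1ℤ ≡ - (1ℤ + i)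
  lemma = solve-∀

-- δ P = 1 - (1 - ε)^P = P ε + O(ε²). Weights are multiplied by δ P so that a
-- discounted sum over a cycle whose length divides P has integer coefficients.
δ : ℕ → Series
δ P = one ⊟ Λ^ P one

δ₀ : ∀ P → δ P 0 ≡ 0ℤ
δ₀ P = cong (λ i → 1ℤ - i) (Λ^-one₀ P)

δ₁ : ∀ P → δ P 1 ≡ + P
δ₁ P = trans (cong (λ i → 0ℤ - i) (Λ^-one₁ P)) (lemma (+ P))
  where
  lemma : ∀ i → 0ℤ - (- i) ≡ i
  lemma = solve-∀

module FunctionalGraph {A : Set} (f : A → A) (c : A → ℤ) where

  -- The discounted sum of the first k costs from s.
  U : ℕ → A → Series
  U zero    s = λ _ → 0ℤ
  U (suc k) s = c s • one ⊞ Λ (U k (f s))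

  -- `U k s` is the sum of the terms `(1 - ε)^i c (f^i s)` for `i < k`. Passing to `f s` and
  -- multiplying by `1 - ε` shifts the range by one, so only the terms 0 and `k` survive.
  U-telescopes : ∀ k s → U k s ⊟ Λ (U k (f s)) ≗
                 c s • one ⊟ Λ^ k (c (iterate f s k) • one)
  U-telescopes zero s zero = sym (+-inverseʳ (c s * 1ℤ))
  U-telescopes zero s (suc n) = sym (+-inverseʳ (c s * 0ℤ))
  U-telescopes (suc k) s n = begin
    (a + l) - Λ (c s′ • one ⊞ Λ (U k (f s′))) n
      ≡⟨ cong (λ i → (a + l) - i) (Λ-⊞ (c s′ • one) (Λ (U k (f s′))) n) ⟩
    (a + l) - (Λ (c s′ • one) n + l₂)
      ≡⟨ lemma a l (Λ (c s′ • one) n) l₂ ⟩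
    a - (Λ (c s′ • one) n - (l - l₂))
      ≡⟨ cong (λ i → a - (Λ (c s′ • one) n - i)) (Λ-⊟ (U k s′) (Λ (U k (f s′))) n) ⟨
    a - (Λ (c s′ • one) n - Λ (U k s′ ⊟ Λ (U k (f s′))) n)
      ≡⟨ cong (λ i → a - (Λ (c s′ • one) n - i))
           (trans (Λ-cong (U-telescopes k s′) n) (Λ-⊟ (c s′ • one) _ n)) ⟩
    a - (Λ (c s′ • one) n - (Λ (c s′ • one) n - r))
      ≡⟨ lemma₂ a (Λ (c s′ • one) n) r ⟩
    a - r ∎
    where
    open ≡-Reasoning
    s′ = f s
    a  = (c s • one) n
    l  = Λ (U k s′) n
    l₂ = Λ (Λ (U k (f s′))) n
    r  = Λ (Λ^ k (c (iterate f s′ k) • one)) n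
    lemma : ∀ a l b m → (a + l) - (b + m) ≡ a - (b - (l - m))
    lemma = solve-∀
    lemma₂ : ∀ a b r → a - (b - (b - r)) ≡ a - r
    lemma₂ = solve-∀

  -- With `u` the infinite discounted sum, `v` is `u - (1 - ε)^P u`: expand the first `u` after
  -- `m + P` terms and the second after `m`. The two tails cancel because `f^(m + P) s = f^m s`.
  discounted : ∀ m P → (∀ s → iterate f s (m ℕ.+ P) ≡ iterate f s m) →
    ∃ λ (v : A → Series) → ∀ s → v s ≗ c s • δ P ⊞ Λ (v (f s))
  discounted m P periodic = v , eq
    where
    v : A → Series
    v s = U (m ℕ.+ P) s ⊟ Λ^ P (U m s)
    eq : ∀ s → v s ≗ c s • δ P ⊞ Λ (v (f s))
    eq s n = begin
      a - b
        ≡⟨ lemma a b a′ b′ ⟩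
      (a - a′) - (b - b′) + (a′ - b′)
        ≡⟨ cong₂ (λ i j → i - j + (a′ - b′)) (U-telescopes (m ℕ.+ P) s n) tele ⟩
      (c s * one n - r) - (c s * Λ^ P one n - r′) + (a′ - b′)
        ≡⟨ cong (λ i → (c s * one n - i) - (c s * Λ^ P one n - r′) + (a′ - b′)) r≡r′ ⟩
      (c s * one n - r′) - (c s * Λ^ P one n - r′) + (a′ - b′)
        ≡⟨ lemma₂ (c s) (one n) (Λ^ P one n) r′ (a′ - b′) ⟩
      c s * (one n - Λ^ P one n) + (a′ - b′)
        ≡⟨ cong (λ i → c s * (one n - Λ^ P one n) + i) (Λ-⊟ (U (m ℕ.+ P) (f s)) _ n) ⟨
      c s * (one n - Λ^ P one n) + Λ (v (f s)) n ∎
      where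
      open ≡-Reasoning
      a  = U (m ℕ.+ P) s n
      a′ = Λ (U (m ℕ.+ P) (f s)) n
      b  = Λ^ P (U m s) n
      b′ = Λ (Λ^ P (U m (f s))) n
      r  = Λ^ (m ℕ.+ P) (c (iterate f s (m ℕ.+ P)) • one) n
      e  = c (iterate f s m) • one
      r′ = Λ^ P (Λ^ m e) n
      tele : b - b′ ≡ c s * Λ^ P one n - r′
      tele = begin
        b - b′
          ≡⟨ cong (λ x → b - x n) (Λ^-Λ P (U m (f s))) ⟨
        b - Λ^ P (Λ (U m (f s))) n
          ≡⟨ Λ^-⊟ P (U m s) (Λ (U m (f s))) n ⟨
        Λ^ P (U m s ⊟ Λ (U m (f s))) n
          ≡⟨ Λ^-cong P (U-telescopes m s) n ⟩
        Λ^ P (c s • one ⊟ Λ^ m e) n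
          ≡⟨ Λ^-⊟ P (c s • one) (Λ^ m e) n ⟩
        Λ^ P (c s • one) n - r′
          ≡⟨ cong (_- r′) (Λ^-• P (c s) one n) ⟩
        c s * Λ^ P one n - r′ ∎
      r≡r′ : r ≡ r′
      r≡r′ = trans (cong (λ t → Λ^ (m ℕ.+ P) (c t • one) n) (periodic s))
        (trans (cong (λ k → Λ^ k e n) (ℕ.+-comm m P)) (cong (λ x → x n) (Λ^-+ P m e)))
      lemma : ∀ a b c d → a - b ≡ (a - c) - (b - d) + (c - d)
      lemma = solve-∀
      lemma₂ : ∀ c x y r z → (c * x - r) - (c * y - r) + z ≡ c * (x - y) + z
      lemma₂ = solve-∀

-- The optimality equation

module _ (G : Game) where
  open Game G

  -- Enumeration of the states and of the moves

  ∣S∣ : ℕ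
  ∣S∣ = ∣S₁∣ ℕ.+ ∣S₂∣

  encode : S → Fin ∣S∣
  encode = Fin.join ∣S₁∣ ∣S₂∣

  encode-injective : ∀ {s t} → encode s ≡ encode t → s ≡ t
  encode-injective {s} {t} eq = trans (sym (Fin.splitAt-join ∣S₁∣ ∣S₂∣ s))
    (trans (cong (Fin.splitAt ∣S₁∣) eq) (Fin.splitAt-join ∣S₁∣ ∣S₂∣ t))

  states : List S
  states = tabulate (Fin.splitAt ∣S₁∣ {∣S₂∣})

  ∈-states : ∀ s → s ∈ states
  ∈-states s = subst (_∈ states) (Fin.splitAt-join ∣S₁∣ ∣S₂∣ s)
    (∈-tabulate⁺ (encode s))

  _≟_ : (s t : S) → Dec (s ≡ t)
  _≟_ = Sum.≡-dec Fin._≟_ Fin._≟_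

  successorsIn : ∀ s → List S → List (Successor s)
  successorsIn s []       = []
  successorsIn s (t ∷ ts) with T? (E s t)
  ... | yes e = (t , e) ∷ successorsIn s ts
  ... | no  _ = successorsIn s ts

  ∈-successorsIn : ∀ {s t} (e : s ⟶ t) {ts} → t ∈ ts →
                   (t , e) ∈ successorsIn s ts
  ∈-successorsIn {s} {t} e (here refl) with T? (E s t)
  ... | yes e′ = here (cong (t ,_) (T-irrelevant e e′))
  ... | no  ¬e = ⊥-elim (¬e e)
  ∈-successorsIn {s} e {u ∷ _} (there t∈ts) with T? (E s u)
  ... | yes _ = there (∈-successorsIn e t∈ts)
  ... | no  _ = ∈-successorsIn e t∈ts

  successors : ∀ s → List (Successor s)
  successors s = successorsIn s states

  ∈-successors : ∀ {s} (y : Successor s) → y ∈ successors s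
  ∈-successors (t , e) = ∈-successorsIn e (∈-states t)

  module Optimality (δ : Series) where

    -- The contribution of one move to the Bellman operator of the discounted game, with weights
    -- scaled by `δ`.
    backup : (S → Series) → ∀ {s} → Successor s → Series
    backup v {s} (t , e) = w s t e • δ ⊞ Λ (v t)

    -- The optimality equation modulo `ε^m`, split into two inequalities. It is relative to a list
    -- of moves so that moves can be added one at a time.
    record Optimal (m : ℕ) (v : S → Series) s (ys : List (Successor s)) : Set where
      field
        attained : Any (λ y → Ord (owner s) m (backup v y) (v s)) ys
        bounding : All (λ y → Ord (owner s) m (v s) (backup v y)) ys
    open Optimal public

    optimal-pred : ∀ {m v s ys} → Optimal (suc m) v s ys → Optimal m v s ys
    optimal-pred {s = s} o = record
      { attained = Any.map (Ord-pred (owner s)) (attained o)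
      ; bounding = All.map (Ord-pred (owner s)) (bounding o)
      }

    argmax : ∀ m (f : S → Series) (s : S) ts →
             ∃ λ s* → f s ≤⟨ m ⟩ f s* × All (λ t → f t ≤⟨ m ⟩ f s*) ts
    argmax m f s [] = s , ≤⟨⟩-reflexive (f s) (f s) (λ _ → refl) , []
    argmax m f s (t ∷ ts) with ≤⟨⟩-total m (f s) (f t)
    ... | inj₁ s≤t = let s* , t≤s* , ts≤s* = argmax m f t ts in
      s* , ≤⟨⟩-trans (f s) (f t) (f s*) s≤t t≤s* , t≤s* ∷ ts≤s*
    ... | inj₂ t≤s = let s* , s≤s* , ts≤s* = argmax m f s ts in
      s* , s≤s* , ≤⟨⟩-trans (f t) (f s) (f s*) t≤s s≤s* ∷ ts≤s*

    -- A maximum principle. Let `d` be the largest value of `a - b`, attained at `s*`. The move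
    -- given there yields `d ≤ (1 - ε) (a t - b t) ≤ (1 - ε) d`, hence `d ≤ 0` to one order less.
    compare₁ : ∀ {m} (a b : S → Series) →
      (∀ s → ∃ λ (y : Successor s) →
         a s ≤⟨ suc m ⟩ backup a y × backup b y ≤⟨ suc m ⟩ b s) →
      ∀ s → a s ≤⟨ m ⟩ b s
    compare₁ {m} a b cross s with argmax (suc m) (λ t → a t ⊟ b t) s states
    ... | s* , _ , max with cross s*
    ...   | y@(t , e) , a≤ , ≤b =
      nonNeg-resp (λ n → lemma (a s n) (b s n) (d n))
        (nonNeg-⊞ (nonNeg-pred (All.lookup max (∈-states s))) (Λ-contracts d d≤Λd))
      where
      d = a s* ⊟ b s*
      lemma : ∀ x y z → (z - (x - y)) + (- z) ≡ y - x
      lemma = solve-∀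
      lemma₂ : ∀ as bs ω at bt z →
        ((ω + at) - as) + (bs - (ω + bt)) + (z - (at - bt)) ≡ z - (as - bs)
      lemma₂ = solve-∀
      d≤Λd : d ≤⟨ suc m ⟩ Λ d
      d≤Λd = nonNeg-resp
        (λ n → trans
          (cong (λ i → (backup a y n - a s* n) + (b s* n - backup b y n) + i)
            (trans (Λ-⊟ d (a t ⊟ b t) n) (cong (λ i → Λ d n - i) (Λ-⊟ (a t) (b t) n))))
          (lemma₂ (a s* n) (b s* n) ((w s* t e • δ) n) (Λ (a t) n) (Λ (b t) n) (Λ d n)))
        (nonNeg-⊞ (nonNeg-⊞ a≤ ≤b) (nonNeg-Λ (All.lookup max (∈-states t))))

    Crossing : Player → ℕ → (a b : S → Series) → S → Set
    Crossing p m a b s = ∃ λ (y : Successor s) →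
      Ord p m (a s) (backup a y) × Ord p m (backup b y) (b s)

    compare : ∀ p {m} (a b : S → Series) → (∀ s → Crossing p (suc m) a b s) →
              ∀ s → Ord p m (a s) (b s)
    compare player₁ a b cross = compare₁ a b cross
    compare player₂ a b cross = compare₁ b a λ s →
      let y , a≥ , ≥b = cross s in y , ≥b , a≥

    -- One solution attains its value by some move, and the other is bounded by that same move. If
    -- `p` owns `s`, the attaining solution is `b`; otherwise it is `a`, and the inequalities are
    -- reversed.
    crossing : ∀ p {m a b s ys} → Optimal m a s ys → Optimal m b s ys →
               Crossing p m a b s
    crossing p {m} {a} {b} {s} oa ob =
      go p (owner s) (attained oa) (bounding oa) (attained ob) (bounding ob)
      where
      Attained : Player → (S → Series) → List (Successor s) → Set
      Attained q v = Any (λ y → Ord q m (backup v y) (v s))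
      Bounding : Player → (S → Series) → List (Successor s) → Set
      Bounding q v = All (λ y → Ord q m (v s) (backup v y))
      go : ∀ p q {ys} → Attained q a ys → Bounding q a ys →
           Attained q b ys → Bounding q b ys → Crossing p m a b s
      go player₁ player₁ aa ba ab bb = meet ba ab
      go player₂ player₂ aa ba ab bb = meet ba ab
      go player₁ player₂ aa ba ab bb = let y , ≥b , a≥ = meet bb aa in y , a≥ , ≥b
      go player₂ player₁ aa ba ab bb = let y , ≥b , a≥ = meet bb aa in y , a≥ , ≥b

    backup-mono : ∀ p {m} (a b : S → Series) → (∀ s → Ord p m (a s) (b s)) →
                  ∀ {s} (y : Successor s) → Ord p m (backup a y) (backup b y)
    backup-mono player₁ {m} a b a≤b {s} (t , e) =
      nonNeg-resp
        (λ n → trans (Λ-⊟ (b t) (a t) n)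
                     (lemma ((w s t e • δ) n) (Λ (b t) n) (Λ (a t) n)))
        (nonNeg-Λ (a≤b t))
      where
      lemma : ∀ c x y → x - y ≡ (c + x) - (c + y)
      lemma = solve-∀
    backup-mono player₂ a b a≥b y = backup-mono player₁ b a a≥b y

    module _ (A : ∀ s → List (Successor s)) (s₀ : S) where

      private p = owner s₀

      record Solves (m : ℕ) (ys : List (Successor s₀)) (v : S → Series) : Set where
        field
          at-s₀ : Optimal m v s₀ ys
          off-s₀ : ∀ s → s ≢ s₀ → Optimal m v s (A s)
      open Solves

      solves-pred : ∀ {m ys v} → Solves (suc m) ys v → Solves m ys v
      solves-pred σ = record
        { at-s₀ = optimal-pred (at-s₀ σ)
        ; off-s₀ = λ s s≢s₀ → optimal-pred (off-s₀ σ s s≢s₀)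
        }

      widenˡ : ∀ {m xs ys v} → Solves m xs v →
               All (λ y → Ord p m (v s₀) (backup v y)) ys → Solves m (xs ++ ys) v
      widenˡ σ ≤ys = record
        { at-s₀ = record
          { attained = Any.++⁺ˡ (attained (at-s₀ σ))
          ; bounding = All.++⁺ (bounding (at-s₀ σ)) ≤ys
          }
        ; off-s₀ = off-s₀ σ
        }

      widenʳ : ∀ {m xs ys v} → Solves m ys v →
               All (λ y → Ord p m (v s₀) (backup v y)) xs → Solves m (xs ++ ys) v
      widenʳ {xs = xs} σ ≤xs = record
        { at-s₀ = record
          { attained = Any.++⁺ʳ xs (attained (at-s₀ σ))
          ; bounding = All.++⁺ ≤xs (bounding (at-s₀ σ))
          }
        ; off-s₀ = off-s₀ σ
        }

      -- Policy improvement: if some move in `ys`, evaluated by `v₁`, is no worse for the owner of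
      -- `s₀` than `v₁ s₀`, that move gives the crossing at `s₀`. At the other states both series
      -- solve the same equation.
      improve : ∀ {m xs ys v₁ v₂} → Solves (suc m) xs v₁ → Solves (suc m) ys v₂ →
                Any (λ y → Ord p (suc m) (backup v₁ y) (v₁ s₀)) ys →
                ∀ s → Ord p m (v₂ s) (v₁ s)
      improve {m} {xs} {ys} {v₁} {v₂} σ₁ σ₂ better = compare p v₂ v₁ cross
        where
        cross : ∀ s → Crossing p (suc m) v₂ v₁ s
        cross s with s ≟ s₀
        ... | yes refl = meet (bounding (at-s₀ σ₂)) better
        ... | no s≢s₀  = crossing p (off-s₀ σ₂ s s≢s₀) (off-s₀ σ₁ s s≢s₀)

      -- Unless one of the two solutions solves the union, each is below the
      -- other by comparison; the comparison costs one order of precision.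
      solves-++ : ∀ {m xs ys} → ∃ (Solves (suc m) xs) → ∃ (Solves (suc m) ys) →
                  ∃ (Solves m (xs ++ ys))
      solves-++ {m} {xs} {ys} (v₁ , σ₁) (v₂ , σ₂)
        with All.decide (λ y → Ord-total p (suc m) (v₁ s₀) (backup v₁ y)) ys
           | All.decide (λ y → Ord-total p (suc m) (v₂ s₀) (backup v₂ y)) xs
      ... | inj₁ ≤ys | _        = v₁ , solves-pred (widenˡ σ₁ ≤ys)
      ... | inj₂ _   | inj₁ ≤xs = v₂ , solves-pred (widenʳ σ₂ ≤xs)
      ... | inj₂ b₁  | inj₂ b₂  = v₁ , widenˡ (solves-pred σ₁) (All.map
        (λ {y} v₂≤ → Ord-trans p (v₁ s₀) (v₂ s₀) (backup v₁ y) (v₁≤v₂ s₀)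
          (Ord-trans p (v₂ s₀) (backup v₂ y) (backup v₁ y) (Ord-pred p v₂≤)
            (backup-mono p v₂ v₁ v₂≤v₁ y)))
        (bounding (at-s₀ σ₂)))
        where
        v₂≤v₁ = improve σ₁ σ₂ b₁
        v₁≤v₂ = improve σ₂ σ₁ b₂

    -- Existence of solutions, by induction on states and moves

    update : (∀ s → List (Successor s)) → ∀ s → List (Successor s) →
             ∀ t → List (Successor t)
    update A s ys t with t ≟ s
    ... | yes refl = ys
    ... | no  _    = A t

    update-same : ∀ A s ys → update A s ys s ≡ ys
    update-same A s ys with s ≟ s
    ... | yes refl = refl
    ... | no s≢s   = ⊥-elim (s≢s refl)

    update-other : ∀ A s ys {t} → t ≢ s → update A s ys t ≡ A t
    update-other A s ys {t} t≢s with t ≟ s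
    ... | yes t≡s = ⊥-elim (t≢s t≡s)
    ... | no _    = refl

    -- The solution may depend on `m`. Asking for all `m` leaves room for the orders of precision
    -- lost whenever two lists are joined.
    Solvable : (∀ s → List (Successor s)) → Set
    Solvable A = ∀ m → ∃ λ v → ∀ s → Optimal m v s (A s)

    module _ (solvable-deterministic : (f : ∀ s → Successor s) → Solvable (λ s → f s ∷ []))
      where

      -- Induction on `ss`, outside which every state has a single move. Keeping one move at the
      -- head reduces to the tail; the remaining moves at the head are then joined one by one.
      solvable : ∀ ss A → (∀ t → t ∉ ss → ∃ λ y → A t ≡ y ∷ []) →
                 (∀ t → ∃ λ y → ∃ λ ys → A t ≡ y ∷ ys) → Solvable A
      solvable [] A single nonempty m =
        let v , opt = solvable-deterministic (λ s → proj₁ (single s λ ())) m in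
        v , λ s → subst (Optimal m v s) (sym (proj₂ (single s λ ()))) (opt s)
      solvable (s ∷ ss) A single nonempty m
        with nonempty s
      ... | y , ys , As≡ with inner y ys m
        where
        base : ∀ y m → ∃ (Solves A s m (y ∷ []))
        base y m with solvable ss (update A s (y ∷ [])) single′ nonempty′ m
          where
          single′ : ∀ t → t ∉ ss → ∃ λ z → update A s (y ∷ []) t ≡ z ∷ []
          single′ t t∉ss with t ≟ s
          ... | yes refl = y , refl
          ... | no t≢s   = single t λ { (here t≡s) → t≢s t≡s ; (there t∈ss) → t∉ss t∈ss }
          nonempty′ : ∀ t → ∃ λ z → ∃ λ zs → update A s (y ∷ []) t ≡ z ∷ zs
          nonempty′ t with t ≟ s
          ... | yes refl = y , [] , refl
          ... | no _     = nonempty t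
        ... | v , opt = v , record
          { at-s₀  = subst (Optimal m v s) (update-same A s (y ∷ [])) (opt s)
          ; off-s₀ = λ t t≢s → subst (Optimal m v t) (update-other A s (y ∷ []) t≢s) (opt t)
          }
        inner : ∀ y ys m → ∃ (Solves A s m (y ∷ ys))
        inner y []       m = base y m
        -- Both parts are solved to one order more, which joining them uses up.
        inner y (z ∷ zs) m = solves-++ A s (base y (suc m)) (inner z zs (suc m))
      ... | v , σ = v , opt
        where
        opt : ∀ t → Optimal m v t (A t)
        opt t with t ≟ s
        ... | yes refl = subst (Optimal m v t) (sym As≡) (Solves.at-s₀ σ)
        ... | no t≢s   = Solves.off-s₀ σ t t≢s

  -- A multiple of the cycle lengths of all functional graphs on `S`, so that the same scaling of
  -- the weights serves every choice of moves.
  period : ℕ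
  period = ∣S∣ !

  open Optimality (δ period) public

  solvable-deterministic : (f : ∀ s → Successor s) → Solvable (λ s → f s ∷ [])
  solvable-deterministic f m
    with FunctionalGraph.discounted (proj₁ ∘ f) (λ s → w s (proj₁ (f s)) (proj₂ (f s)))
           ∣S∣ period (iterate-period encode encode-injective (proj₁ ∘ f))
  ... | v , eq = v , λ s → record
    { attained = here (Ord-reflexive (owner s) (backup v (f s)) (v s) (sym ∘ eq s))
    ; bounding = Ord-reflexive (owner s) (v s) (backup v (f s)) (eq s) ∷ []
    }

  solution : ∀ m → ∃ λ v → ∀ s → Optimal m v s (successors s)
  solution = solvable solvable-deterministic states successors
    (λ t t∉states → ⊥-elim (t∉states (∈-states t)))
    (λ t → nonempty (∈-successors (total t)))
    where
    nonempty : ∀ {A : Set} {x : A} {xs} → x ∈ xs → ∃ λ y → ∃ λ ys → xs ≡ y ∷ ys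
    nonempty {xs = y ∷ ys} _ = y , ys , refl

-- Bounds for sums of energies

0≤+ : ∀ {i j} → 0ℤ ≤ i → 0ℤ ≤ j → 0ℤ ≤ i + j
0≤+ = +-mono-≤

0≤* : ∀ {i j} → 0ℤ ≤ i → 0ℤ ≤ j → 0ℤ ≤ i * j
0≤* {i} {j} 0≤i 0≤j = subst (_≤ i * j) (*-zeroʳ i)
  (*-monoˡ-≤-nonNeg i {{nonNegative 0≤i}} 0≤j)

0≤+* : ∀ n {j} → 0ℤ ≤ j → 0ℤ ≤ + n * j
0≤+* n = 0≤* (+≤+ (ℕ.z≤n {n}))

0≤⇒≤ : ∀ {i j d} → 0ℤ ≤ d → j - i ≡ d → i ≤ j
0≤⇒≤ 0≤d eq = 0≤i-j⇒j≤i (subst (0ℤ ≤_) (sym eq) 0≤d)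

<⇒1+≤ : ∀ {i j} → i < j → 1ℤ + i ≤ j
<⇒1+≤ = i<j⇒suc[i]≤j

1+≤⇒< : ∀ {i j} → 1ℤ + i ≤ j → i < j
1+≤⇒< = suc[i]≤j⇒i<j

0≤+n : ∀ {n} → 0ℤ ≤ + n
0≤+n = +≤+ ℕ.z≤n

i≤+∣i∣ : ∀ i → i ≤ + ∣ i ∣
i≤+∣i∣ (+ n)    = ≤-refl
i≤+∣i∣ -[1+ n ] = -≤+

-- D = x 0 - (P E + x) is the amount by which the potential P E + x has
-- dropped, and b a lower bound for D not exceeding K. A strict step may raise k
-- by K: this is paid for by the growth of b while b < K, and afterwards by D
-- itself, which every step subtracts from the sum of the energies.
module Potential
  (P : ℤ) (1≤P : 1ℤ ≤ P) (K : ℕ) (x k ω E T : ℕ → ℤ)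
  (E₀ : E 0 ≡ 0ℤ) (T₀ : T 0 ≡ 0ℤ)
  (E₊ : ∀ n → E (suc n) ≡ E n + ω n) (T₊ : ∀ n → T (suc n) ≡ T n + E (suc n))
  where

  Strict Tight : ℕ → Set
  Strict n = 1ℤ + (P * ω n + x (suc n)) ≤ x n ×
             k (suc n) - P * x (suc n) ≤ k n + + K
  Tight  n = P * ω n + x (suc n) ≤ x n × k (suc n) - P * x (suc n) ≤ k n

  lost : ℕ → ℤ
  lost n = x 0 - (P * E n + x n)

  Invariant : ℕ → ℕ → Set
  Invariant n b = b ℕ.≤ K × + b ≤ lost n ×
    P * (P * T n) + k n ≤ + n * (P * x 0) + k 0 + + K * + b

  private
    0≤P : 0ℤ ≤ P
    0≤P = ≤-trans 0≤+n 1≤P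

    lost-suc : ∀ n i → i + (P * ω n + x (suc n)) ≤ x n → i + lost n ≤ lost (suc n)
    lost-suc n i h = 0≤⇒≤ (i≤j⇒0≤j-i h)
      (trans (cong (λ e → (x 0 - (P * e + x (suc n))) - (i + lost n)) (E₊ n))
        (lemma (x 0) P (E n) (ω n) (x n) (x (suc n)) i))
      where
      lemma : ∀ x₀ P e ω x x′ i →
        (x₀ - (P * (e + ω) + x′)) - (i + (x₀ - (P * e + x))) ≡ x - (i + (P * ω + x′))
      lemma = solve-∀

    -- The accounting shared by all steps. By definition of `lost`, `P * E (suc n)` is
    -- `x 0 - x (suc n) - lost (suc n)`. Thus `P * lost (suc n)` and the growth of `K * b` pay for
    -- the rise `c` of `k`, and `d` is left over.
    sum-suc : ∀ n {b b′ c d} →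
      P * (P * T n) + k n ≤ + n * (P * x 0) + k 0 + + K * + b →
      k (suc n) - P * x (suc n) ≤ k n + c →
      0ℤ ≤ d → P * lost (suc n) + + K * + b′ ≡ d + c + + K * + b →
      P * (P * T (suc n)) + k (suc n) ≤ + suc n * (P * x 0) + k 0 + + K * + b′
    sum-suc n {b} {b′} {c} {d} ih hk 0≤d eq =
      0≤⇒≤ (0≤+ (0≤+ (i≤j⇒0≤j-i ih) (i≤j⇒0≤j-i hk)) 0≤d) (begin
        (+ suc n * (P * x 0) + k 0 + + K * + b′) - (P * (P * T (suc n)) + k (suc n))
          ≡⟨ cong (λ t → (+ suc n * (P * x 0) + k 0 + + K * + b′) -
                         (P * (P * t) + k (suc n))) (T₊ n) ⟩
        (+ suc n * (P * x 0) + k 0 + + K * + b′) - (P * (P * (T n + E (suc n))) + k (suc n))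
          ≡⟨ lemma (+ n) P (x 0) (k 0) (+ K) (+ b′) (T n) (E (suc n)) (x (suc n)) (k (suc n)) ⟩
        (P * lost (suc n) + + K * + b′) + rest
          ≡⟨ cong (_+ rest) eq ⟩
        (d + c + + K * + b) + rest
          ≡⟨ lemma₂ (+ n) P (x 0) (k 0) (+ K * + b) (T n) (k n) (x (suc n)) (k (suc n)) c d ⟩
        ((+ n * (P * x 0) + k 0 + + K * + b) - (P * (P * T n) + k n)) +
          ((k n + c) - (k (suc n) - P * x (suc n))) + d ∎)
      where
      open ≡-Reasoning
      rest = + n * (P * x 0) + k 0 - P * (P * T n) - (k (suc n) - P * x (suc n))
      lemma : ∀ n P x₀ k₀ K b′ t e x′ k′ →
        ((1ℤ + n) * (P * x₀) + k₀ + K * b′) - (P * (P * (t + e)) + k′) ≡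
        (P * (x₀ - (P * e + x′)) + K * b′) +
          (n * (P * x₀) + k₀ - P * (P * t) - (k′ - P * x′))
      lemma = solve-∀
      lemma₂ : ∀ n P x₀ k₀ Kb t k x′ k′ c d →
        (d + c + Kb) + (n * (P * x₀) + k₀ - P * (P * t) - (k′ - P * x′)) ≡
        ((n * (P * x₀) + k₀ + Kb) - (P * (P * t) + k)) + ((k + c) - (k′ - P * x′)) + d
      lemma₂ = solve-∀

  invariant-suc : ∀ n → Strict n ⊎ Tight n → ∃ (Invariant n) → ∃ (Invariant (suc n))
  invariant-suc n (inj₂ (hx , hk)) (b , b≤K , b≤D , ih) =
    b , b≤K , b≤D′ ,
    sum-suc n ih (≤-trans hk (≤-reflexive (sym (+-identityʳ (k n)))))
      (0≤* 0≤P (≤-trans 0≤+n b≤D′))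
      (cong (_+ + K * + b) (sym (+-identityʳ (P * lost (suc n)))))
    where
    b≤D′ : + b ≤ lost (suc n)
    b≤D′ = ≤-trans b≤D (subst (_≤ lost (suc n)) (+-identityˡ (lost n))
      (lost-suc n 0ℤ (≤-trans (≤-reflexive (+-identityˡ _)) hx)))
  invariant-suc n (inj₁ (hx , hk)) (b , b≤K , b≤D , ih)
    with ℕ.m≤n⇒m<n∨m≡n b≤K
  ... | inj₁ b<K = suc b , b<K , b<D′ ,
    sum-suc n ih hk (0≤* 0≤P (≤-trans 0≤+n b<D′))
      (lemma (P * lost (suc n)) (+ K) (+ b))
    where
    b<D′ : 1ℤ + + b ≤ lost (suc n)
    b<D′ = ≤-trans (+-monoʳ-≤ 1ℤ b≤D) (lost-suc n 1ℤ hx)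
    lemma : ∀ d K b → d + K * (1ℤ + b) ≡ d + K + K * b
    lemma = solve-∀
  ... | inj₂ refl = b , b≤K , b≤D′ ,
    sum-suc n ih hk
      (0≤+ (0≤* (i≤j⇒0≤j-i 1≤P) (≤-trans 0≤+n b≤D′)) (i≤j⇒0≤j-i b≤D′))
      (lemma P (lost (suc n)) (+ b))
    where
    b≤D′ : + b ≤ lost (suc n)
    b≤D′ = ≤-trans b≤D (≤-trans (i≤j+i (lost n) 1ℤ) (lost-suc n 1ℤ hx))
    lemma : ∀ P d K → P * d + K * K ≡ ((P - 1ℤ) * d + (d - K)) + K + K * K
    lemma = solve-∀

  invariant : (∀ n → Strict n ⊎ Tight n) → ∀ n → ∃ (Invariant n)
  invariant step zero = 0 , ℕ.z≤n , ≤-reflexive (sym lost₀) , ≤-reflexive sum₀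
    where
    lost₀ : lost 0 ≡ 0ℤ
    lost₀ = trans (cong (λ e → x 0 - (P * e + x 0)) E₀) (lemma (x 0) P)
      where
      lemma : ∀ x P → x - (P * 0ℤ + x) ≡ 0ℤ
      lemma = solve-∀
    sum₀ : P * (P * T 0) + k 0 ≡ + 0 * (P * x 0) + k 0 + + K * + 0
    sum₀ = trans (cong (λ t → P * (P * t) + k 0) T₀) (lemma P (k 0) (x 0) (+ K))
      where
      lemma : ∀ P k x K → P * (P * 0ℤ) + k ≡ 0ℤ * (P * x) + k + K * 0ℤ
      lemma = solve-∀
  invariant step (suc n) = invariant-suc n (step n) (invariant step n)

  sum-bound : (∀ n → Strict n ⊎ Tight n) → ∀ {B : ℕ} → (∀ n → k 0 - k n ≤ + B) →
              ∀ n → P * (P * T n) ≤ + n * (P * x 0) + + (K ℕ.* K ℕ.+ B)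
  sum-bound step {B} hB n with invariant step n
  ... | b , b≤K , _ , h = 0≤⇒≤
    (0≤+ (0≤+ (i≤j⇒0≤j-i h) (i≤j⇒0≤j-i (hB n)))
         (0≤+* K (i≤j⇒0≤j-i (+≤+ b≤K))))
    (trans (cong (λ c → + n * (P * x 0) + c - P * (P * T n))
             (trans (pos-+ (K ℕ.* K) B) (cong (_+ + B) (pos-* K K))))
      (lemma (+ n * (P * x 0)) (P * (P * T n)) (k 0) (k n) (+ K) (+ b) (+ B)))
    where
    lemma : ∀ X T k₀ k K b B → X + (K * K + B) - T ≡
      (X + k₀ + K * b - (T + k)) + (B - (k₀ - k)) + K * (K - b)
    lemma = solve-∀

-- Bounds for limits superior

/-cancel-< : ∀ {i n q} .{{_ : ℕ.NonZero n}} → i ℚ./ n ℚ.< q → i * ↧ q < ↥ q * + n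
/-cancel-< {i} {suc n} {q@record{}} h
  with ℚᵘ.<-respˡ-≃ (ℚ.toℚᵘ-fromℚᵘ (ℚᵘ.mkℚᵘ i n)) (ℚ.toℚᵘ-mono-< h)
... | ℚᵘ.*<* h′ = h′

/-mono-< : ∀ {i n q} .{{_ : ℕ.NonZero n}} → i * ↧ q < ↥ q * + n → i ℚ./ n ℚ.< q
/-mono-< {i} {suc n} {q@record{}} h = ℚ.toℚᵘ-cancel-<
  (ℚᵘ.<-respˡ-≃ (ℚᵘ.≃-sym (ℚ.toℚᵘ-fromℚᵘ (ℚᵘ.mkℚᵘ i n))) (ℚᵘ.*<* h))

<-/-cancel : ∀ {i n q} .{{_ : ℕ.NonZero n}} → q ℚ.< i ℚ./ n → ↥ q * + n < i * ↧ q
<-/-cancel {i} {suc n} {q@record{}} h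
  with ℚᵘ.<-respʳ-≃ (ℚ.toℚᵘ-fromℚᵘ (ℚᵘ.mkℚᵘ i n)) (ℚ.toℚᵘ-mono-< h)
... | ℚᵘ.*<* h′ = h′

<-/-mono : ∀ {i n q} .{{_ : ℕ.NonZero n}} → ↥ q * + n < i * ↧ q → q ℚ.< i ℚ./ n
<-/-mono {i} {suc n} {q@record{}} h = ℚ.toℚᵘ-cancel-<
  (ℚᵘ.<-respʳ-≃ (ℚᵘ.≃-sym (ℚ.toℚᵘ-fromℚᵘ (ℚᵘ.mkℚᵘ i n))) (ℚᵘ.*<* h))

module _ (T : ℕ → ℤ) {Q : ℕ} .{{_ : ℕ.NonZero Q}} {X : ℤ} {C : ℕ} where

  limsup-upper : (∀ n → + Q * T n ≤ + n * X + + C) →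
                 limsup (λ n → T (suc n) ℚ./ suc n) ≤ᴿ fromℚ (X ℚ./ Q)
  limsup-upper bound q X/Q<q with ℚ.<-dense X/Q<q
  ... | p , X/Q<p , p<q = N , p , p<q , λ k → /-mono-< {T (suc (N ℕ.+ k))} (below k)
    where
    -- As integers, `↥ p * Q` exceeds `X * ↧ p` by at least 1, so after multiplication by `n` the
    -- gap exceeds the error `C * ↧ p` once `n > N`.
    N = C ℕ.* ↧ₙ p
    below : ∀ k → T (suc (N ℕ.+ k)) * ↧ p < ↥ p * + suc (N ℕ.+ k)
    below k = *-cancelˡ-<-nonNeg (+ Q) (1+≤⇒< (0≤⇒≤
      (0≤+ (0≤+ (0≤+* (↧ₙ p) (i≤j⇒0≤j-i (bound n)))
                (0≤+* n (i≤j⇒0≤j-i (<⇒1+≤ (/-cancel-< {X} X/Q<p)))))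
           (0≤+n {k}))
      (trans (lemma (+ Q) (T n) (↧ p) (↥ p) (+ n) X (+ C))
        (cong (λ i → ↧ p * (+ n * X + + C - + Q * T n) +
                     + n * (↥ p * + Q - (1ℤ + X * ↧ p)) + i) N+k))))
      where
      n = suc (N ℕ.+ k)
      N+k : + n - (1ℤ + + C * ↧ p) ≡ + k
      N+k = trans (cong₂ (λ i j → 1ℤ + i - (1ℤ + j)) (pos-+ N k) (sym (pos-* C (↧ₙ p))))
        (lemma₂ (+ N) (+ k))
        where
        lemma₂ : ∀ N k → 1ℤ + (N + k) - (1ℤ + N) ≡ k
        lemma₂ = solve-∀
      lemma : ∀ Q T b a n X C → Q * (a * n) - (1ℤ + Q * (T * b)) ≡
        b * (n * X + C - Q * T) + n * (a * Q - (1ℤ + X * b)) + (n - (1ℤ + C * b))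
      lemma = solve-∀

  limsup-lower : (∀ n → + Q * - T n ≤ + n * X + + C) →
                 fromℚ ((- X) ℚ./ Q) ≤ᴿ limsup (λ n → T (suc n) ℚ./ suc n)
  limsup-lower bound q (N , p , p<q , below) = ℚ.≤-<-trans (ℚ.≮⇒≥ absurd) p<q
    where
    k = C ℕ.* ↧ₙ p
    n = suc (N ℕ.+ k)
    absurd : ¬ p ℚ.< (- X) ℚ./ Q
    -- At this index the gap between `p` and `- X / Q` would exceed the error: a weighted sum of the
    -- three inequalities, all nonnegative, equals -1.
    absurd p<-X/Q = <⇒≱ -<+ (subst (0ℤ ≤_) ≡-1
      (0≤+ (0≤+ (0≤+ (0≤+* (↧ₙ p) (i≤j⇒0≤j-i (bound n)))
                     (0≤+* Q (i≤j⇒0≤j-i (<⇒1+≤ (/-cancel-< {T n} {n} (below k))))))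
                (0≤+* n (i≤j⇒0≤j-i (<⇒1+≤ (<-/-cancel { - X} {Q} p<-X/Q)))))
           (0≤+n {N ℕ.+ Q})))
      where
      ≡-1 :
        ↧ p * (+ n * X + + C - + Q * - T n) + + Q * (↥ p * + n - (1ℤ + T n * ↧ p)) +
        + n * ((- X) * ↧ p - (1ℤ + ↥ p * + Q)) + (+ N + + Q) ≡ -1ℤ
      ≡-1 = trans
        (cong (λ i → ↧ p * (i * X + + C - + Q * - T n) + + Q * (↥ p * i - (1ℤ + T n * ↧ p)) +
                     i * ((- X) * ↧ p - (1ℤ + ↥ p * + Q)) + (+ N + + Q))
          (cong (_+_ 1ℤ) (trans (pos-+ N k) (cong (_+_ (+ N)) (pos-* C (↧ₙ p))))))
        (lemma (+ Q) (T n) (↧ p) (↥ p) (+ N) X (+ C))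
        where
        lemma : ∀ Q T b a N X C → let n = 1ℤ + (N + C * b) in
          b * (n * X + C - Q * - T) + Q * (a * n - (1ℤ + T * b)) +
          n * ((- X) * b - (1ℤ + a * Q)) + (N + Q) ≡ -1ℤ
        lemma = solve-∀

-- Energy bounds along plays

bounded-on : ∀ {X : Set} (f : X → ℤ) xs → ∃ λ (B : ℕ) → ∀ {x} → x ∈ xs → f x ≤ + B
bounded-on f []       = 0 , λ ()
bounded-on f (x ∷ xs) with bounded-on f xs
... | B , f≤B = ∣ f x ∣ ℕ.+ B , λ
  { (here refl)  → ≤-trans (i≤+∣i∣ (f x)) (+≤+ (ℕ.m≤m+n ∣ f x ∣ B))
  ; (there x∈xs) → ≤-trans (f≤B x∈xs) (+≤+ (ℕ.m≤n+m B ∣ f x ∣))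
  }

-- Multiplication by this sign makes either player a minimiser, so that one argument serves both.
sgn : Player → ℤ
sgn player₁ = 1ℤ
sgn player₂ = -1ℤ

Ord⇒NonNeg : ∀ p {m} x y → Ord p m x y → NonNeg m (sgn p • (y ⊟ x))
Ord⇒NonNeg player₁ x y = nonNeg-resp λ n → sym (*-identityˡ (y n - x n))
Ord⇒NonNeg player₂ x y = nonNeg-resp λ n → lemma (x n) (y n)
  where
  lemma : ∀ x y → x - y ≡ -1ℤ * (y - x)
  lemma = solve-∀

1≤* : ∀ {i j} → 1ℤ ≤ i → 1ℤ ≤ j → 1ℤ ≤ i * j
1≤* {i} {j} 1≤i 1≤j = 0≤⇒≤
  (0≤+ (0≤* (i≤j⇒0≤j-i 1≤i) (≤-trans 0≤+n 1≤j)) (i≤j⇒0≤j-i 1≤j)) (lemma i j)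
  where
  lemma : ∀ i j → i * j - 1ℤ ≡ (i - 1ℤ) * j + (j - 1ℤ)
  lemma = solve-∀

unbounded-below : ∀ {P b a₀} → 1ℤ ≤ P → 1ℤ ≤ b → a₀ < 0ℤ →
  ∀ a₁ c (R : ℕ) → ∃ λ r → P * (a₁ + + (R ℕ.+ r) * a₀) * b < c
unbounded-below {P} {b} {a₀} 1≤P 1≤b a₀<0 a₁ c R = r ,
  1+≤⇒< (0≤⇒≤ (0≤+ (0≤+* (R ℕ.+ r) (i≤j⇒0≤j-i 1≤t))
                   (0≤+ (0≤+n {R}) (i≤j⇒0≤j-i (i≤+∣i∣ d))))
    (trans (lemma P b a₀ a₁ c (+ (R ℕ.+ r)))
      (cong (_+_ (+ (R ℕ.+ r) * (t - 1ℤ)))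
        (trans (cong (λ i → i - 1ℤ - d) (pos-+ R r)) (lemma₂ (+ R) (+ ∣ d ∣) d)))))
  where
  d = P * a₁ * b - c
  -- Each unit of `R + r` lowers the product by `t ≥ 1`, and it has to fall by more than `d`.
  r = suc ∣ d ∣
  t = P * b * - a₀
  1≤t : 1ℤ ≤ t
  1≤t = 1≤* (1≤* 1≤P 1≤b) (0≤⇒≤ (i≤j⇒0≤j-i (<⇒1+≤ a₀<0)) (lemma₃ a₀))
    where
    lemma₃ : ∀ a → - a - 1ℤ ≡ 0ℤ - (1ℤ + a)
    lemma₃ = solve-∀
  lemma : ∀ P b a₀ a₁ c R → c - (1ℤ + P * (a₁ + R * a₀) * b) ≡
    R * (P * b * - a₀ - 1ℤ) + (R - 1ℤ - (P * a₁ * b - c))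
  lemma = solve-∀
  lemma₂ : ∀ R e d → R + (1ℤ + e) - 1ℤ - d ≡ R + (e - d)
  lemma₂ = solve-∀

module _ (G : Game) where
  open Game G
  open Play
  open Strategy

  bounded-on-states : (f : S → ℤ) → ∃ λ (B : ℕ) → ∀ s → f s ≤ + B
  bounded-on-states f with bounded-on f (states G)
  ... | B , f≤B = B , λ s → f≤B (∈-states G s)

  bounded-on-edges : (f : ∀ s → Successor s → ℤ) → ∃ λ (B : ℕ) → ∀ s y → f s y ≤ + B
  bounded-on-edges f with bounded-on-states (λ s → + proj₁ (bounded-on (f s) (successors G s)))
  ... | B , f≤B = B , λ s y →
    ≤-trans (proj₂ (bounded-on (f s) (successors G s)) (∈-successors G y)) (f≤B s)

  -- Precision 3 keeps the coefficients of 1, `ε` and `ε²`, which are all that the energy bound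
  -- uses.
  module Certificate (v : S → Series) (optimal : ∀ s → Optimal G 3 v s (successors G s)) where

    best : ∀ s → Successor s
    best s = proj₁ (Any.satisfied (attained (optimal s)))

    strategy : ∀ p → Strategy G p
    strategy p .move {s = s} _ _ = best s

    strategy-memoryless : ∀ p → Memoryless (strategy p)
    strategy-memoryless p _ _ _ = refl

    -- At a state of `p` the edge is the best move and `attained` applies. At a state of the
    -- opponent `bounding` applies to any edge, the opponent's order being the reverse of that of
    -- `p`.
    backup-≤ : ∀ p s (y : Successor s) → (owner s ≡ p → proj₁ (best s) ≡ proj₁ y) →
               Ord p 3 (backup G v y) (v s)
    backup-≤ p s y follows = go p (owner s) follows
      (proj₂ (Any.satisfied (attained (optimal s))))
      (All.lookup (bounding (optimal s)) (∈-successors G y))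
      where
      same : ∀ {t} {y z : Σ S t} → (∀ s (e e′ : t s) → e ≡ e′) → proj₁ y ≡ proj₁ z → y ≡ z
      same irr refl = cong (_,_ _) (irr _ _ _)
      best≡ : proj₁ (best s) ≡ proj₁ y → best s ≡ y
      best≡ = same (λ _ → T-irrelevant)
      go : ∀ p q → (q ≡ p → proj₁ (best s) ≡ proj₁ y) →
           Ord q 3 (backup G v (best s)) (v s) → Ord q 3 (v s) (backup G v y) →
           Ord p 3 (backup G v y) (v s)
      go player₁ player₁ f att _ =
        subst (λ z → Ord player₁ 3 (backup G v z) (v s)) (best≡ (f refl)) att
      go player₂ player₂ f att _ =
        subst (λ z → Ord player₂ 3 (backup G v z) (v s)) (best≡ (f refl)) att
      go player₁ player₂ _ _ bnd = bnd
      go player₂ player₁ _ _ bnd = bnd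

    Pℤ : ℤ
    Pℤ = + period G

    1≤P : 1ℤ ≤ Pℤ
    1≤P = +≤+ (ℕ.1≤n! (∣S∣ G))

    module Energy (p : Player) where

      a : ℕ → S → ℤ
      a n s = sgn p * v s n

      cost : ∀ s → Successor s → ℤ
      cost s (t , e) = sgn p * w s t e

      q : ℤ
      q = δ (period G) 2

      -- Combined with the ε-coefficient of the optimality equation, which is an
      -- equation for tight edges, the ε²-coefficient bounds the increase of k.
      k : S → ℤ
      k s = Pℤ * a 2 s - q * a 1 s

      R₀ : ℕ
      R₀ = suc (proj₁ (bounded-on-edges λ s y → Pℤ * cost s y + a 1 (proj₁ y) - a 1 s))

      R₀-bound : ∀ s y → 1ℤ + (Pℤ * cost s y + a 1 (proj₁ y) - a 1 s) ≤ + R₀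
      R₀-bound s y = +-monoʳ-≤ 1ℤ (proj₂ (bounded-on-edges _) s y)

      module _ (r : ℕ) where

        R : ℕ
        R = R₀ ℕ.+ r

        -- R is so large that P E + h drops strictly whenever a₀ does.
        h : S → ℤ
        h s = a 1 s + + R * a 0 s

        K : ℕ
        K = proj₁ (bounded-on-edges λ s y → k (proj₁ y) - Pℤ * h (proj₁ y) - k s)

        K-bound : ∀ s y → k (proj₁ y) - Pℤ * h (proj₁ y) ≤ k s + + K
        K-bound s y = 0≤⇒≤
          (i≤j⇒0≤j-i (proj₂ (bounded-on-edges
            λ s y → k (proj₁ y) - Pℤ * h (proj₁ y) - k s) s y))
          (lemma (k s) (+ K) (k (proj₁ y) - Pℤ * h (proj₁ y)))
          where
          lemma : ∀ k K i → k + K - i ≡ K - (i - k)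
          lemma = solve-∀

        StrictEdge TightEdge : ∀ s → Successor s → Set
        StrictEdge s y = 1ℤ + (Pℤ * cost s y + h (proj₁ y)) ≤ h s ×
                         k (proj₁ y) - Pℤ * h (proj₁ y) ≤ k s + + K
        TightEdge  s y = Pℤ * cost s y + h (proj₁ y) ≤ h s ×
                         k (proj₁ y) - Pℤ * h (proj₁ y) ≤ k s

        module _ {s} (y : Successor s) where
          private
            t  = proj₁ y
            -- The slack of the optimality inequality along the edge, counted in favour of `p`; `z₁`
            -- and `z₂` are its next two coefficients.
            z  = sgn p • (v s ⊟ backup G v y)
            z₁ = a 1 s - (Pℤ * cost s y + a 1 t - a 0 t)
            z₂ = a 2 s - (q * cost s y + a 2 t - a 1 t)

          gap₀ : z 0 ≡ a 0 s - a 0 t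
          gap₀ = trans (cong (λ d → sgn p * (v s 0 - (w s t _ * d + v t 0))) (δ₀ (period G)))
            (lemma (sgn p) (w s t _) (v s 0) (v t 0))
            where
            lemma : ∀ σ w x y → σ * (x - (w * 0ℤ + y)) ≡ σ * x - σ * y
            lemma = solve-∀

          gap₁ : z 1 ≡ z₁
          gap₁ = trans
            (cong (λ d → sgn p * (v s 1 - (w s t _ * d + (v t 1 - v t 0))))
              (δ₁ (period G)))
            (lemma (sgn p) (w s t _) Pℤ (v s 1) (v t 1) (v t 0))
            where
            lemma : ∀ σ w P x y u → σ * (x - (w * P + (y - u))) ≡
              σ * x - (P * (σ * w) + σ * y - σ * u)
            lemma = solve-∀

          gap₂ : z 2 ≡ z₂
          gap₂ = lemma (sgn p) (w s t _) q (v s 2) (v t 2) (v t 1)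
            where
            lemma : ∀ σ w P x y u → σ * (x - (w * P + (y - u))) ≡
              σ * x - (P * (σ * w) + σ * y - σ * u)
            lemma = solve-∀

          strict-drop : a 0 t < a 0 s → StrictEdge s y
          strict-drop a₀< = 0≤⇒≤
            (0≤+ (0≤+* R (i≤j⇒0≤j-i (<⇒1+≤ a₀<)))
                 (i≤j⇒0≤j-i (≤-trans (R₀-bound s y) (+≤+ (ℕ.m≤m+n R₀ r)))))
            (lemma (+ R) (a 0 s) (a 0 t) (a 1 s) (a 1 t) (Pℤ * cost s y)) , K-bound s y
            where
            lemma : ∀ R a a′ b b′ c → (b + R * a) - (1ℤ + (c + (b′ + R * a′))) ≡
              R * (a - (1ℤ + a′)) + (R - (1ℤ + (c + b′ - b)))
            lemma = solve-∀

          -- The multiples of `R` cancel, and the potential drops by `z₁ - a 0 t`; the second term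
          -- is due to the discount.
          strict-level : a 0 s ≡ a 0 t → 1ℤ ≤ z₁ - a 0 t → StrictEdge s y
          strict-level a₀≡ 1≤ = 0≤⇒≤ (i≤j⇒0≤j-i 1≤)
            (trans (cong (λ i → (a 1 s + + R * i) - (1ℤ + (Pℤ * cost s y + h t))) a₀≡)
              (lemma (+ R) (a 0 t) (a 1 s) (a 1 t) (Pℤ * cost s y))) , K-bound s y
            where
            lemma : ∀ R a b b′ c → (b + R * a) - (1ℤ + (c + (b′ + R * a))) ≡
              (b - (c + b′ - a)) - a - 1ℤ
            lemma = solve-∀

          -- The cost cancels in `P z₂ - q z₁`, which leaves the inequality for `k`.
          tight-level : a 0 s ≡ 0ℤ → a 0 t ≡ 0ℤ → z₁ ≡ 0ℤ → 0ℤ ≤ z₂ → TightEdge s y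
          tight-level s≡0 t≡0 z₁≡0 0≤z₂ =
            ≤-reflexive (sym (i-j≡0⇒i≡j (h s) _ (begin
              h s - (Pℤ * cost s y + h t)
                ≡⟨ lemma (+ R) (a 0 s) (a 0 t) (a 1 s) (a 1 t) (Pℤ * cost s y) ⟩
              z₁ + (+ R * a 0 s - + R * a 0 t - a 0 t)
                ≡⟨ cong₂ _+_ z₁≡0 (cong₂ (λ i j → + R * i - + R * j - j) s≡0 t≡0) ⟩
              0ℤ + (+ R * 0ℤ - + R * 0ℤ - 0ℤ)
                ≡⟨ lemma₁ (+ R) ⟩
              0ℤ ∎))) ,
            0≤⇒≤ (0≤* (≤-trans 0≤+n 1≤P) 0≤z₂) (begin
              k s - (k t - Pℤ * h t)
                ≡⟨ lemma₂ Pℤ q (+ R) (cost s y) (a 0 t) (a 1 s) (a 1 t) (a 2 s) (a 2 t) ⟩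
              Pℤ * z₂ - q * (z₁ - a 0 t) + Pℤ * (+ R * a 0 t)
                ≡⟨ cong₂ (λ i j → Pℤ * z₂ - q * (i - j) + Pℤ * (+ R * j)) z₁≡0 t≡0 ⟩
              Pℤ * z₂ - q * (0ℤ - 0ℤ) + Pℤ * (+ R * 0ℤ)
                ≡⟨ lemma₃ (Pℤ * z₂) q Pℤ (+ R) ⟩
              Pℤ * z₂ ∎)
            where
            open ≡-Reasoning
            lemma : ∀ R a a′ b b′ c → (b + R * a) - (c + (b′ + R * a′)) ≡
              (b - (c + b′ - a′)) + (R * a - R * a′ - a′)
            lemma = solve-∀
            lemma₁ : ∀ R → 0ℤ + (R * 0ℤ - R * 0ℤ - 0ℤ) ≡ 0ℤ
            lemma₁ = solve-∀
            lemma₂ : ∀ P q R w a′ b b′ c c′ →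
              (P * c - q * b) - ((P * c′ - q * b′) - P * (b′ + R * a′)) ≡
              P * (c - (q * w + c′ - b′)) - q * (b - (P * w + b′ - a′) - a′) + P * (R * a′)
            lemma₂ = solve-∀
            lemma₃ : ∀ i q P R → i - q * (0ℤ - 0ℤ) + P * (R * 0ℤ) ≡ i
            lemma₃ = solve-∀

          -- The first nonzero coefficient of the slack decides. If it is that of 1 or of `ε`, the
          -- step is strict. If both vanish, the discount still makes the step strict when `a 0` is
          -- negative, and it is tight when `a 0` is zero.
          edge-step : Ord p 3 (backup G v y) (v s) → a 0 s ≤ 0ℤ →
                      a 0 t ≤ 0ℤ × (StrictEdge s y ⊎ TightEdge s y)
          edge-step o s≤0 with Ord⇒NonNeg p (backup G v y) (v s) o
          ... | lead 0<z₀ = ≤-trans (<⇒≤ a₀<) s≤0 , inj₁ (strict-drop a₀<)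
            where
            a₀< : a 0 t < a 0 s
            a₀< = 1+≤⇒< (0≤⇒≤ (i≤j⇒0≤j-i (<⇒1+≤ (subst (0ℤ <_) gap₀ 0<z₀)))
                              (lemma (a 0 s) (a 0 t)))
              where
              lemma : ∀ i j → i - (1ℤ + j) ≡ i - j - (1ℤ + 0ℤ)
              lemma = solve-∀
          ... | cont z₀≡0 rest = t≤0 , level rest
            where
            a₀≡ : a 0 s ≡ a 0 t
            a₀≡ = i-j≡0⇒i≡j (a 0 s) (a 0 t) (trans (sym gap₀) z₀≡0)
            t≤0 : a 0 t ≤ 0ℤ
            t≤0 = subst (_≤ 0ℤ) a₀≡ s≤0
            level : NonNeg 2 (z ∘ suc) → StrictEdge s y ⊎ TightEdge s y
            level (lead 0<z₁) = inj₁ (strict-level a₀≡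
              (+-mono-≤ (<⇒1+≤ (subst (0ℤ <_) gap₁ 0<z₁)) (neg-mono-≤ t≤0)))
            level (cont z₁≡0 rest′) with <-cmp (a 0 t) 0ℤ
            ... | tri< t<0 _ _ = inj₁ (strict-level a₀≡
              (+-mono-≤ (≤-reflexive (sym (trans (sym gap₁) z₁≡0))) (<⇒1+≤ (neg-mono-< t<0))))
            ... | tri> _ _ 0<t = ⊥-elim (<⇒≱ 0<t t≤0)
            ... | tri≈ _ t≡0 _ = inj₂
              (tight-level (trans a₀≡ t≡0) t≡0 (trans (sym gap₁) z₁≡0) (0≤z₂ rest′))
              where
              0≤z₂ : NonNeg 1 (z ∘ suc ∘ suc) → 0ℤ ≤ z₂
              0≤z₂ (lead 0<z₂)  = <⇒≤ (subst (0ℤ <_) gap₂ 0<z₂)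
              0≤z₂ (cont z₂≡0 _) = ≤-reflexive (trans (sym z₂≡0) gap₂)

        module _ (π : Play G) (consistent : Consistent (strategy p) π)
                 (start : a 0 (at π 0) ≤ 0ℤ) where

          private
            y : ∀ n → Successor (at π n)
            y n = at π (suc n) , edge π n

          edge-≤ : ∀ n → Ord p 3 (backup G v (y n)) (v (at π n))
          edge-≤ n = backup-≤ p (at π n) (y n) (consistent n)

          stays : ∀ n → a 0 (at π n) ≤ 0ℤ
          stays zero    = start
          stays (suc n) = proj₁ (edge-step (y n) (edge-≤ n) (stays n))

          energy-bound : ∃ λ (C : ℕ) → ∀ n →
            Pℤ * (Pℤ * (sgn p * totalEL π n)) ≤ + n * (Pℤ * h (at π 0)) + + C
          energy-bound with bounded-on-states (λ s → k (at π 0) - k s)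
          ... | B , hB = K ℕ.* K ℕ.+ B ,
            Potential.sum-bound Pℤ 1≤P K (h ∘ at π) (k ∘ at π) (λ n → cost (at π n) (y n))
              (λ n → sgn p * EL (prefix π n)) (λ n → sgn p * totalEL π n)
              (*-zeroʳ (sgn p)) (*-zeroʳ (sgn p))
              (λ n → *-distribˡ-+ (sgn p) _ _) (λ n → *-distribˡ-+ (sgn p) _ _)
              (λ n → proj₂ (edge-step (y n) (edge-≤ n) (stays n)))
              (hB ∘ at π)

-- Values

-∞ +∞ : ℝ̄
-∞ = ⨅ fromℚ
+∞ = ⨅ {⊥} λ ()

∃> : ∀ t → ∃ λ q → t ℚ.< q
∃> t = t ℚ.+ ℚ.1ℚ , subst (ℚ._< t ℚ.+ ℚ.1ℚ) (ℚ.+-identityʳ t)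
  (ℚ.+-monoʳ-< t (ℚ.positive⁻¹ ℚ.1ℚ))

module _ (G : Game) where
  open Game G
  open Play

  module _ (σ₁ : Strategy G player₁) (σ₂ : Strategy G player₂) where

    -- That `x` is the value follows from the two bounds. Decidability of comparison with rationals
    -- yields determinacy constructively.
    record HasValue (s : S) (x : ℝ̄) : Set where
      field
        upper : ∀ π → at π 0 ≡ s → Consistent σ₁ π → AE π ≤ᴿ x
        lower : ∀ π → at π 0 ≡ s → Consistent σ₂ π → x ≤ᴿ AE π
        _≤?   : ∀ t → Dec (x ≤ᴿ fromℚ t)

    module _ {s x} (hv : HasValue s x) where
      open HasValue hv

      winning₁ : ∀ {t} → x ≤ᴿ fromℚ t → Winning₁ s (AvgEnergy t) σ₁
      winning₁ x≤t τ q t<q =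
        upper (outcome σ₁ τ s) refl (Outcome.consistent₁ σ₁ τ s) q (x≤t q t<q)

      below : ∀ {t} → ∃ (Winning₁ s (AvgEnergy t)) → x ≤ᴿ fromℚ t
      below (τ , wins) q t<q =
        lower (outcome τ σ₂ s) refl (Outcome.consistent₂ τ σ₂ s) q (wins σ₂ q t<q)

      determined : ∀ t → ∃ (Winning₁ s (AvgEnergy t)) ⊎ ∃ (Winning₂ s (AvgEnergy t))
      determined t with t ≤?
      ... | yes x≤t = inj₁ (σ₁ , winning₁ x≤t)
      ... | no  x≰t = inj₂ (σ₂ , λ τ wins → x≰t λ q t<q →
        lower (outcome τ σ₂ s) refl (Outcome.consistent₂ τ σ₂ s) q (wins q t<q))

      optimal₁ : ∀ π → at π 0 ≡ s → Consistent σ₁ π → AE π ≤ᴿ value G s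
      optimal₁ π π₀ c q ((t , win) , t<q) = upper π π₀ c q (below win q t<q)

      optimal₂ : ∀ π → at π 0 ≡ s → Consistent σ₂ π → value G s ≤ᴿ AE π
      optimal₂ π π₀ c q AE<q with round x (lower π π₀ c q AE<q)
      -- The value is an infimum over rational thresholds, so `σ₁` has to win for a rational
      -- strictly between `x` and `q`.
      ... | p , p<q , x<p = (p , σ₁ , winning₁ λ r p<r → up x p<r x<p) , p<q

  -- From a solution of the optimality equation to the value

  module _ (v : S → Series) (optimal : ∀ s → Optimal G 3 v s (successors G s)) where
    open Certificate G v optimal

    private
      -- The total energy is bounded with the factor `P²`, one `P` from scaling the weights and one
      -- from summing the potential.
      Q : ℕ
      Q = period G ℕ.* period G

      instance
        P≢0 : ℕ.NonZero (period G)
        P≢0 = ∣S∣ G ℕ.!≢0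
        Q≢0 : ℕ.NonZero Q
        Q≢0 = ℕ.m*n≢0 (period G) (period G)

    module _ (p : Player) where
      open Energy p public using (a; R₀; h)

    X : Player → ℕ → S → ℤ
    X p r s = Pℤ * h p r s

    scale : ∀ p i → + Q * (sgn p * i) ≡ Pℤ * (Pℤ * (sgn p * i))
    scale p i = trans (cong (_* (sgn p * i)) (pos-* (period G) (period G))) (*-assoc Pℤ Pℤ _)

    AE-upper : ∀ r π → Consistent (strategy player₁) π → a player₁ 0 (at π 0) ≤ 0ℤ →
               AE π ≤ᴿ fromℚ (X player₁ r (at π 0) ℚ./ Q)
    AE-upper r π c a₀≤0 = let C , bound = Energy.energy-bound player₁ r π c a₀≤0 in
      limsup-upper (totalEL π) λ n → ≤-trans (≤-reflexive
        (trans (cong (+ Q *_) (sym (*-identityˡ (totalEL π n))))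
               (scale player₁ (totalEL π n)))) (bound n)

    AE-lower : ∀ r π → Consistent (strategy player₂) π → a player₂ 0 (at π 0) ≤ 0ℤ →
               fromℚ ((- X player₂ r (at π 0)) ℚ./ Q) ≤ᴿ AE π
    AE-lower r π c a₀≤0 = let C , bound = Energy.energy-bound player₂ r π c a₀≤0 in
      limsup-lower (totalEL π) λ n → ≤-trans (≤-reflexive
        (trans (cong (+ Q *_) (sym (-1*i≡-i (totalEL π n))))
               (scale player₂ (totalEL π n)))) (bound n)

    X-unbounded : ∀ p s → a p 0 s < 0ℤ → ∀ q c → ∃ λ r → X p r s * ↧ q < c
    X-unbounded p s a₀<0 q c =
      unbounded-below 1≤P (+≤+ (ℕ.s≤s ℕ.z≤n)) a₀<0 (a p 1 s) c (R₀ p)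

    -- Without the multiple of `R` the bounds of the two players coincide up to sign, which makes
    -- the value finite and exact.
    X₀ : ∀ p r s → v s 0 ≡ 0ℤ → X p r s ≡ sgn p * (Pℤ * v s 1)
    X₀ p r s v₀≡0 = trans
      (cong (λ i → Pℤ * (sgn p * v s 1 + + (R₀ p ℕ.+ r) * (sgn p * i))) v₀≡0)
      (lemma Pℤ (sgn p) (v s 1) (+ (R₀ p ℕ.+ r)))
      where
      lemma : ∀ P σ i R → P * (σ * i + R * (σ * 0ℤ)) ≡ σ * (P * i)
      lemma = solve-∀

    -- The sign of `v s 0` decides. If it is nonzero, the player whom it favours has a bound for
    -- every `r`, and these bounds are unbounded in that player's favour.
    has-value : ∀ s → ∃ (HasValue (strategy player₁) (strategy player₂) s)
    has-value s with <-cmp (v s 0) 0ℤ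
    ... | tri< v₀<0 _ _ = -∞ , record
      { upper = λ { π refl c q _ →
          let a₀<0 = subst (_< 0ℤ) (sym (*-identityˡ _)) v₀<0
              r , X< = X-unbounded player₁ (at π 0) a₀<0 q (↥ q * + Q)
          in AE-upper r π c (<⇒≤ a₀<0) q (/-mono-< {X player₁ r (at π 0)} X<) }
      ; lower = λ { π _ _ q AE<q → let p , p<q , _ = round (AE π) AE<q in p , p<q }
      ; _≤?   = λ t → yes λ q t<q → t , t<q
      }
    ... | tri> _ _ 0<v₀ = +∞ , record
      { upper = λ { _ _ _ _ (() , _) }
      ; lower = λ { π refl c q AE<q →
          let a₀<0 = subst (_< 0ℤ) (sym (-1*i≡-i _)) (neg-mono-< 0<v₀)
              r , X< = X-unbounded player₂ (at π 0) a₀<0 q (- (↥ q * + Q))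
              -X<q = AE-lower r π c (<⇒≤ a₀<0) q AE<q
              q<-X = <-/-mono { - X player₂ r (at π 0)} {Q} {q}
                (subst₂ _<_ (neg-involutive _) (neg-distribˡ-* (X player₂ r (at π 0)) (↧ q))
                  (neg-mono-< X<))
          in ⊥-elim (ℚ.<-asym -X<q q<-X) }
      ; _≤?   = λ t → no λ +∞≤t → let q , t<q = ∃> t in proj₁ (+∞≤t q t<q)
      }
    ... | tri≈ _ v₀≡0 _ = fromℚ x , record
      { upper = λ { π refl c → subst (λ i → AE π ≤ᴿ fromℚ (i ℚ./ Q)) X₁
          (AE-upper 0 π c (≤-reflexive (cong (1ℤ *_) v₀≡0))) }
      ; lower = λ { π refl c → subst (λ i → fromℚ (i ℚ./ Q) ≤ᴿ AE π) X₂
          (AE-lower 0 π c (≤-reflexive (cong (-1ℤ *_) v₀≡0))) }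
      ; _≤?   = λ t → Dec.map′ fromℚ-mono fromℚ-cancel (x ℚ.≤? t)
      }
      where
      x = (Pℤ * v s 1) ℚ./ Q
      X₁ : X player₁ 0 s ≡ Pℤ * v s 1
      X₁ = trans (X₀ player₁ 0 s v₀≡0) (*-identityˡ _)
      X₂ : - X player₂ 0 s ≡ Pℤ * v s 1
      X₂ = trans (cong -_ (trans (X₀ player₂ 0 s v₀≡0) (-1*i≡-i _))) (neg-involutive _)

theorem5 : (G : Game) (s : Game.S G) →
    ((t : ℚ) →
       (∃ λ (σ₁ : Strategy G player₁) → Winning₁ s (AvgEnergy t) σ₁) ⊎
       (∃ λ (σ₂ : Strategy G player₂) → Winning₂ s (AvgEnergy t) σ₂))
    × (∃ λ (σ₁ : Strategy G player₁) → Memoryless σ₁ ×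
       ((π : Play G) → Play.at π 0 ≡ s → Consistent σ₁ π → AE π ≤ᴿ value G s))
    × (∃ λ (σ₂ : Strategy G player₂) → Memoryless σ₂ ×
       ((π : Play G) → Play.at π 0 ≡ s → Consistent σ₂ π → value G s ≤ᴿ AE π))
theorem5 G s =
  let v , optimal = solution G 3
      open Certificate G v optimal
      σ₁ = strategy player₁
      σ₂ = strategy player₂
      hv = proj₂ (has-value G v optimal s)
  in determined G σ₁ σ₂ hv ,
     (σ₁ , strategy-memoryless player₁ , optimal₁ G σ₁ σ₂ hv) ,
     (σ₂ , strategy-memoryless player₂ , optimal₂ G σ₁ σ₂ hv)
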